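{- For $x=(x_0,\ldots,x_{n-1})\in\mathbb{B}^n$, let $\mathrm{S}(x)=\{i\in X_n: x_i=1\}$ be the support of $x$. Then $x\mathbf{P}_n=x$ (matrix multiplication over the Boolean algebra $\mathbb{B}$) if and only if $\mathrm{S}(x)$ is an order ideal of the Pascal poset $\mathbb{P}_n$. Moreover, $$D_P(n)=\bigl|\{x\in\mathbb{B}^n : x\mathbf{P}_n=x\}\bigr|.$$
   Context: $X_n=\{0,1,\ldots,n-1\}$, and $\mathbb{B}=\{0,1\}$ is the Boolean algebra with $a+b=\max\{a,b\}$ and $a\cdot b=\min\{a,b\}$. The binary Pascal matrix $\mathbf{P}_n$ is the $n\times n$ $(0,1)$-matrix with $(\mathbf{P}_n)_{i,j}\equiv\binom{i}{j}\pmod2$, $0\le i,j\le n-1$, regarded as a matrix over $\mathbb{B}$; $x\in\mathbb{B}^n$ is a row vector. The Pascal poset $\mathbb{P}_n$ is the poset on $X_n$ with $j\preceq i$ iff $(\mathbf{P}_n)_{i,j}=1$. An order ideal of a poset is a subset $J$ such that $x\in J$ and $y\preceq x$ imply $y\in J$. The Dedekind-Pascal number $D_P(n)$ is the number of antichains of $\mathbb{P}_n$ (including the empty antichain). -}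

module Defs where

import Algebra.Properties.CommutativeMonoid.Sum
open import Data.Bool.Base using (Bool; true; false; _∧_)
import Data.Bool.Properties as Bool
open import Data.Fin.Base using (Fin; toℕ)
import Data.Fin.Properties as Fin
open import Data.Fin.Subset using (Subset; _∈_)
open import Data.Fin.Subset.Properties using (_∈?_)
open import Data.List.Base using (List; []; _∷_; [_]; _++_; map; filter; length)
open import Data.List.Membership.Propositional using () renaming (_∈_ to _∈ₗ_)
open import Data.List.Membership.Propositional.Properties
  using (∈-map⁺; ∈-map⁻; ∈-++⁺ˡ; ∈-++⁺ʳ)
open import Data.List.Relation.Unary.All using ([])
open import Data.List.Relation.Unary.AllPairs using ([]; _∷_)
open import Data.List.Relation.Unary.Any using (here)
open import Data.List.Relation.Unary.Unique.Propositional using (Unique)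
import Data.List.Relation.Unary.Unique.Propositional.Properties as Unique
open import Data.Nat.Base using (ℕ; zero; suc; _+_; _*_; _∸_; _≤_; s≤s; _≡ᵇ_; _!; NonZero)
open import Data.Nat.Combinatorics using (_C_; nCk≡n!/k![n-k]!; k![n∸k]!∣n!; k>n⇒nCk≡0; nCn≡1)
open import Data.Nat.DivMod using (_%_; m%n<n; m/n*n≡m; /-congʳ)
open import Data.Nat.Divisibility using (_∣_; m%n≡0⇒n∣m; n∣m⇒m%n≡0; ∣m⇒∣m*n)
open import Data.Nat.Primality using (euclidsLemma; prime[2])
import Data.Nat.Properties as ℕ
open import Data.Nat.Solver using (module +-*-Solver)
open import Data.Product.Base using (_,_; proj₂)
open import Data.Sum.Base using ([_,_]′)
open import Data.Vec.Base using (Vec; []; _∷_; lookup; tabulate)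
import Data.Vec.Properties as Vec
open import Level using (Level; _⊔_; 0ℓ)
open import Relation.Binary.Bundles using (Poset)
open import Relation.Binary.Core using (Rel)
open import Relation.Binary.Definitions using (DecidableEquality)
open import Relation.Binary.PropositionalEquality
  using (_≡_; _≢_; refl; sym; trans; cong; subst; isEquivalence; module ≡-Reasoning)
open import Relation.Binary.Structures using (IsPartialOrder)
open import Relation.Nullary using (Dec; ¬_; yes; no; contradiction)
open import Relation.Nullary.Decidable using (_→-dec_)
open import Relation.Unary using (Pred; Decidable)

open Algebra.Properties.CommutativeMonoid.Sum Bool.∨-commutativeMonoid using (sum)

private
  variable
    a b c ℓ : Level

module _ (P : Poset a b c) where
  open Poset P renaming (_≤_ to _⊑_)

  IsOrderIdeal : Pred Carrier ℓ → Set (a ⊔ c ⊔ ℓ)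
  IsOrderIdeal J = ∀ x y → J x → y ⊑ x → J y

  IsAntichain : Pred Carrier ℓ → Set (a ⊔ b ⊔ c ⊔ ℓ)
  IsAntichain A = ∀ x y → A x → A y → x ⊑ y → x ≈ y

-- 𝔹 is Bool with + = _∨_ and · = _∧_; `sum` is the iterated _∨_.

𝔹^ : ℕ → Set
𝔹^ n = Vec Bool n

Matrix : ℕ → Set
Matrix n = Fin n → Fin n → Bool

infixl 7 _⊙_
_⊙_ : ∀ {n} → 𝔹^ n → Matrix n → 𝔹^ n
x ⊙ M = tabulate λ j → sum λ i → lookup x i ∧ M i j

_≟_ : ∀ {n} → DecidableEquality (𝔹^ n)
_≟_ = Vec.≡-dec Bool._≟_

S : ∀ {n} → 𝔹^ n → Pred (Fin n) 0ℓ
S x i = lookup x i ≡ true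

𝐏 : ∀ n → Matrix n
𝐏 n i j = (toℕ i C toℕ j) % 2 ≡ᵇ 1

_≼_ : ∀ {n} → Rel (Fin n) 0ℓ
_≼_ {n} j i = 𝐏 n i j ≡ true

private
  Odd : ℕ → Set
  Odd m = (m % 2 ≡ᵇ 1) ≡ true

  odd⇒2∤ : ∀ m → Odd m → ¬ 2 ∣ m
  odd⇒2∤ m o 2∣m with m % 2 | n∣m⇒m%n≡0 m 2 2∣m
  odd⇒2∤ m () 2∣m | .0 | refl

  2∤⇒odd : ∀ m → ¬ 2 ∣ m → Odd m
  2∤⇒odd m 2∤m with m % 2 in eq | m%n<n m 2
  ... | 0           | _ = contradiction (m%n≡0⇒n∣m m 2 eq) 2∤m
  ... | 1           | _ = refl
  ... | suc (suc _) | s≤s (s≤s ())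

  binomial-! : ∀ p q → ((p + q) C p) * (p ! * q !) ≡ (p + q) !
  binomial-! p q = subst (λ r → ((p + q) C p) * (p ! * r !) ≡ (p + q) !)
    (ℕ.m+n∸m≡n p q)
    (trans (cong (_* d) (nCk≡n!/k![n-k]! p≤p+q)) (m/n*n≡m (k![n∸k]!∣n! p≤p+q)))
    where
    p≤p+q = ℕ.m≤m+n p q
    d = p ! * (p + q ∸ p) !
    instance
      d≢0 : NonZero d
      d≢0 = p ℕ.!* (p + q ∸ p) !≢0

  -- C(i,j) · C(j,k) = C(i,k) · C(i-k,j-k) with j = k + p and i = k + p + q; it gives
  -- transitivity of _≼_ below.
  trinomial : ∀ k p q →
    ((k + p + q) C (k + p)) * ((k + p) C k) ≡ ((k + p + q) C k) * ((p + q) C p)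
  trinomial k p q = ℕ.*-cancelʳ-≡ _ _ (k ! * (p ! * q !)) (begin
    A * B * (k ! * (p ! * q !))     ≡⟨ solve 5 (λ A B x y z → A :* B :* (x :* (y :* z)) := A :* (B :* (x :* y) :* z)) refl A B (k !) (p !) (q !) ⟩
    A * (B * (k ! * p !) * q !)     ≡⟨ cong (λ r → A * (r * q !)) (binomial-! k p) ⟩
    A * ((k + p) ! * q !)           ≡⟨ binomial-! (k + p) q ⟩
    (k + p + q) !                   ≡⟨ cong _! (ℕ.+-assoc k p q) ⟩
    (k + (p + q)) !                 ≡⟨ binomial-! k (p + q) ⟨
    C′ * (k ! * (p + q) !)          ≡⟨ cong (λ r → C′ * (k ! * r)) (binomial-! p q) ⟨
    C′ * (k ! * (D * (p ! * q !)))  ≡⟨ solve 5 (λ C D x y z → C :* (x :* (D :* (y :* z))) := C :* D :* (x :* (y :* z))) refl C′ D (k !) (p !) (q !) ⟩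
    C′ * D * (k ! * (p ! * q !))    ≡⟨ cong (λ r → (r C k) * D * (k ! * (p ! * q !))) (ℕ.+-assoc k p q) ⟨
    E * D * (k ! * (p ! * q !))     ∎)
    where
    open ≡-Reasoning
    open +-*-Solver
    A  = (k + p + q) C (k + p)
    B  = (k + p) C k
    C′ = (k + (p + q)) C k
    D  = (p + q) C p
    E  = (k + p + q) C k
    instance
      k!p!q!≢0 : NonZero (k ! * (p ! * q !))
      k!p!q!≢0 = ℕ.m*n≢0 (k !) (p ! * q !) {{k ℕ.!≢0}} {{p ℕ.!* q !≢0}}

  odd-C⇒≤ : ∀ i j → Odd (i C j) → j ≤ i
  odd-C⇒≤ i j o with j ℕ.≤? i
  ... | yes j≤i = j≤i
  ... | no  j≰i with i C j | k>n⇒nCk≡0 (ℕ.≰⇒> j≰i)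
  odd-C⇒≤ i j () | no j≰i | .0 | refl

  odd-C-trans : ∀ i j k → Odd (i C j) → Odd (j C k) → Odd (i C k)
  odd-C-trans i j k oij ojk
    with p , refl ← ℕ.m≤n⇒∃[o]m+o≡n (odd-C⇒≤ j k ojk)
    with q , refl ← ℕ.m≤n⇒∃[o]m+o≡n (odd-C⇒≤ i j oij)
    = 2∤⇒odd (i C k) λ 2∣ik →
        [ odd⇒2∤ (i C j) oij , odd⇒2∤ (j C k) ojk ]′
          (euclidsLemma (i C j) (j C k) prime[2]
            (subst (2 ∣_) (sym (trinomial k p q)) (∣m⇒∣m*n ((p + q) C p) 2∣ik)))

≼-isPartialOrder : ∀ {n} → IsPartialOrder _≡_ (_≼_ {n})
≼-isPartialOrder = record
  { isPreorder = record
    { isEquivalence = isEquivalence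
    ; reflexive     = λ { {i} refl → cong (λ m → m % 2 ≡ᵇ 1) (nCn≡1 (toℕ i)) }
    ; trans         = λ {k} {j} {i} k≼j j≼i → odd-C-trans (toℕ i) (toℕ j) (toℕ k) j≼i k≼j
    }
  ; antisym = λ {j} {i} j≼i i≼j → Fin.toℕ-injective
      (ℕ.≤-antisym (odd-C⇒≤ (toℕ i) (toℕ j) j≼i) (odd-C⇒≤ (toℕ j) (toℕ i) i≼j))
  }

ℙ : ℕ → Poset 0ℓ 0ℓ 0ℓ
ℙ n = record { isPartialOrder = ≼-isPartialOrder {n} }

vectors : ∀ n → List (Vec Bool n)
vectors zero    = [ [] ]
vectors (suc n) = map (true ∷_) (vectors n) ++ map (false ∷_) (vectors n)

-- `vectors n` lists every element of Vec Bool n exactly once, so that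
-- `card` below really is the cardinality of {x ∣ P x}.

vectors-complete : ∀ {n} (x : Vec Bool n) → x ∈ₗ vectors n
vectors-complete []                  = here refl
vectors-complete (true  ∷ x)         = ∈-++⁺ˡ (∈-map⁺ (true ∷_) (vectors-complete x))
vectors-complete {suc n} (false ∷ x) =
  ∈-++⁺ʳ (map (true ∷_) (vectors n)) (∈-map⁺ (false ∷_) (vectors-complete x))

vectors-unique : ∀ n → Unique (vectors n)
vectors-unique zero    = [] ∷ []
vectors-unique (suc n) = Unique.++⁺
  (Unique.map⁺ Vec.∷-injectiveʳ (vectors-unique n))
  (Unique.map⁺ Vec.∷-injectiveʳ (vectors-unique n))
  λ (∈t , ∈f) → true∷≢false∷
    (trans (sym (proj₂ (proj₂ (∈-map⁻ (true ∷_) ∈t)))) (proj₂ (proj₂ (∈-map⁻ (false ∷_) ∈f))))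
  where
  true∷≢false∷ : ∀ {n} {x y : Vec Bool n} → _≢_ {A = Vec Bool (suc n)} (true ∷ x) (false ∷ y)
  true∷≢false∷ ()

card : ∀ {n} (P : Pred (Vec Bool n) ℓ) → Decidable P → ℕ
card {n = n} P P? = length (filter P? (vectors n))

antichain? : ∀ {n} (A : Subset n) → Dec (IsAntichain (ℙ n) (_∈ A))
antichain? {n} A = Fin.all? λ x → Fin.all? λ y →
  (x ∈? A) →-dec ((y ∈? A) →-dec ((𝐏 n y x Bool.≟ true) →-dec (x Fin.≟ y)))

-- Subset n is Vec Bool n, so `card` counts subsets as well.

D-P : ℕ → ℕ
D-P n = card {n = n} (λ A → IsAntichain (ℙ n) (_∈ A)) antichain?

{-# OPTIONS --safe #-}
-- Over the Boolean algebra, S (x ⊙ 𝐏 n) is the down-closure of S x, so the fixed vectors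
-- are exactly those supported on order ideals. In a finite poset every element lies below
-- a maximal one, hence taking down-closures is a bijection from antichains to order
-- ideals, with inverse J ↦ {maximal elements of J}.
module Submission where

open import Defs
import Algebra.Properties.CommutativeMonoid.Sum
open import Data.Bool.Base using (Bool; true; false; _∧_; _∨_)
import Data.Bool.Properties as Bool
open import Data.Fin.Base using (Fin; zero; suc)
import Data.Fin.Induction as Fin
import Data.Fin.Properties as Fin
open import Data.Fin.Subset using (_∈_)
open import Data.List.Base using (List; map; filter; length)
open import Data.List.Membership.Propositional using () renaming (_∈_ to _∈ₗ_)
open import Data.List.Membership.Propositional.Properties
  using (∈-map⁺; ∈-map⁻; ∈-filter⁺; ∈-filter⁻)
open import Data.List.Membership.Propositional.Properties.WithK using (unique∧set⇒bag)
open import Data.List.Properties using (length-map; map-∘; map-id-local)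
open import Data.List.Relation.Binary.BagAndSetEquality using (∼bag⇒↭)
open import Data.List.Relation.Binary.Permutation.Propositional.Properties using (↭-length)
import Data.List.Relation.Unary.All as All
import Data.List.Relation.Unary.All.Properties as All
open import Data.List.Relation.Unary.Unique.Propositional using (Unique)
import Data.List.Relation.Unary.Unique.Propositional.Properties as Unique
open import Data.Nat.Base using (ℕ; suc)
open import Data.Product.Base using (∃; _×_; _,_; proj₁; proj₂)
open import Data.Vec.Base using (lookup; tabulate)
open import Data.Vec.Properties
  using (lookup∘tabulate; tabulate∘lookup; tabulate-cong; []=⇒lookup; lookup⇒[]=)
open import Function.Base using (_∘_; flip)
open import Function.Bundles using (_⇔_; mk⇔; module Equivalence)
open import Induction.WellFounded using (Acc; acc)
open import Level using (Level)
open import Relation.Binary.Bundles using (Poset)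
import Relation.Binary.Construct.NonStrictToStrict as ToStrict
open import Relation.Binary.PropositionalEquality
  using (_≡_; refl; sym; trans; cong; subst; module ≡-Reasoning)
open import Relation.Binary.Structures using (IsPartialOrder)
open import Relation.Nullary using (Dec; does; yes; no; ¬_; ¬?; contradiction)
open import Relation.Nullary.Decidable using (dec-true; _×-dec_)
open import Relation.Unary using (Pred; Decidable)

open Algebra.Properties.CommutativeMonoid.Sum Bool.∨-commutativeMonoid using (sum)
open Equivalence using (to; from)

private
  variable
    a p q : Level
    n : ℕ

does≡true⇔ : {A : Set a} (a? : Dec A) → does a? ≡ true ⇔ A
does≡true⇔ a? = mk⇔ (extract a?) (dec-true a?)
  where
  extract : ∀ {A} (a? : Dec A) → does a? ≡ true → A
  extract (yes a) _ = a

sum≡true⇔ : (t : Fin n → Bool) → sum t ≡ true ⇔ ∃ λ i → t i ≡ true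
sum≡true⇔ t = mk⇔ (witness t) (λ (i , tᵢ) → holds t i tᵢ)
  where
  witness : ∀ {n} (t : Fin n → Bool) → sum t ≡ true → ∃ λ i → t i ≡ true
  witness {suc n} t eq with t zero in t₀
  ... | true  = zero , t₀
  ... | false = let i , tᵢ = witness (t ∘ suc) eq in suc i , tᵢ

  holds : ∀ {n} (t : Fin n → Bool) i → t i ≡ true → sum t ≡ true
  holds t zero    tᵢ = cong (_∨ sum (t ∘ suc)) tᵢ
  holds t (suc i) tᵢ = trans (cong (t zero ∨_) (holds (t ∘ suc) i tᵢ)) (Bool.∨-zeroʳ (t zero))

S-tabulate : (t : Fin n → Bool) (i : Fin n) → S (tabulate t) i ⇔ t i ≡ true
S-tabulate t i = mk⇔ (trans (sym (lookup∘tabulate t i))) (trans (lookup∘tabulate t i))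

S-injective : (x y : 𝔹^ n) → (∀ i → S x i ⇔ S y i) → x ≡ y
S-injective x y Sx⇔Sy = begin
  x                    ≡⟨ tabulate∘lookup x ⟨
  tabulate (lookup x)  ≡⟨ tabulate-cong (λ i → Bool.⇔→≡ (Sx⇔Sy i)) ⟩
  tabulate (lookup y)  ≡⟨ tabulate∘lookup y ⟩
  y                    ∎
  where open ≡-Reasoning

-- A disjunction of conjunctions unfolds to an existential. When `M i j` encodes `j ⊑ i`, the
-- right-hand side describes the down-closure of `S x`.
S-⊙ : (x : 𝔹^ n) (M : Matrix n) (j : Fin n) →
      S (x ⊙ M) j ⇔ ∃ λ i → S x i × M i j ≡ true
S-⊙ x M j = mk⇔
  (λ s → let i , xᵢMᵢⱼ = to (sum≡true⇔ _) (to (S-tabulate _ j) s) in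
    i , Bool.∧-conicalˡ _ _ xᵢMᵢⱼ , Bool.∧-conicalʳ _ _ xᵢMᵢⱼ)
  (λ (i , xᵢ , Mᵢⱼ) → from (S-tabulate _ j) (from (sum≡true⇔ _)
    (i , trans (cong (_∧ M i j) xᵢ) Mᵢⱼ)))

-- Parity of binomial coefficients enters only through `≼-isPartialOrder`, so the argument runs for
-- the incidence matrix of any partial order on `Fin n`.
module _ (M : Matrix n) (isPartialOrder : IsPartialOrder _≡_ (λ j i → M i j ≡ true)) where

  private
    P : Poset _ _ _
    P = record { isPartialOrder = isPartialOrder }

    module P = Poset P

    open P using () renaming (_≤_ to _⊑_)
    open ToStrict _≡_ _⊑_ using () renaming (_<_ to _⊏_)

  -- By reflexivity `S x` always lies in its down-closure, so being fixed amounts to the reverse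
  -- inclusion, which is closure under passing down.
  fixed⇔orderIdeal : (x : 𝔹^ n) → x ⊙ M ≡ x ⇔ IsOrderIdeal P (S x)
  fixed⇔orderIdeal x = mk⇔
    (λ xM≡x i j xᵢ j⊑i → subst (λ y → S y j) xM≡x (from (S-⊙ x M j) (i , xᵢ , j⊑i)))
    (λ ideal → S-injective (x ⊙ M) x λ j → mk⇔
      (λ s → let i , xᵢ , j⊑i = to (S-⊙ x M j) s in ideal i j xᵢ j⊑i)
      (λ xⱼ → from (S-⊙ x M j) (j , xⱼ , P.refl)))

  ⊙-orderIdeal : (x : 𝔹^ n) → IsOrderIdeal P (S (x ⊙ M))
  ⊙-orderIdeal x i j s j⊑i =
    let k , xₖ , i⊑k = to (S-⊙ x M i) s in
    from (S-⊙ x M j) (k , xₖ , P.trans j⊑i i⊑k)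

  StrictlyBelow : 𝔹^ n → Pred (Fin n) _
  StrictlyBelow x i = ∃ λ j → S x j × i ⊏ j

  strictlyBelow? : (x : 𝔹^ n) → Decidable (StrictlyBelow x)
  strictlyBelow? x i = Fin.any? λ j →
    (lookup x j Bool.≟ true) ×-dec ((M j i Bool.≟ true) ×-dec ¬? (i Fin.≟ j))

  Maximal : 𝔹^ n → Pred (Fin n) _
  Maximal x i = S x i × ¬ StrictlyBelow x i

  maximal? : (x : 𝔹^ n) → Decidable (Maximal x)
  maximal? x i = (lookup x i Bool.≟ true) ×-dec ¬? (strictlyBelow? x i)

  maximals : 𝔹^ n → 𝔹^ n
  maximals x = tabulate (does ∘ maximal? x)

  S-maximals : (x : 𝔹^ n) (i : Fin n) → S (maximals x) i ⇔ Maximal x i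
  S-maximals x i = mk⇔
    (to (does≡true⇔ (maximal? x i)) ∘ to (S-tabulate _ i))
    (from (S-tabulate _ i) ∘ from (does≡true⇔ (maximal? x i)))

  maximal-unique : (x : 𝔹^ n) {i j : Fin n} → Maximal x i → S x j → i ⊑ j → i ≡ j
  maximal-unique x {i} {j} (_ , i-max) xⱼ i⊑j with i Fin.≟ j
  ... | yes i≡j = i≡j
  ... | no  i≢j = contradiction (j , xⱼ , i⊑j , i≢j) i-max

  -- Climb within `S x` while something lies strictly above. The strict order on a finite set is
  -- Noetherian, so the climb stops, and it can only stop at a maximal element.
  below-maximal : (x : 𝔹^ n) (i : Fin n) → S x i → ∃ λ j → Maximal x j × i ⊑ j
  below-maximal x i = go (Fin.po-noetherian isPartialOrder i)
    where
    go : ∀ {i} → Acc (flip _⊏_) i → S x i → ∃ λ j → Maximal x j × i ⊑ j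
    go {i} (acc rec) xᵢ with strictlyBelow? x i
    ... | no  i-max = i , (xᵢ , i-max) , P.refl
    ... | yes (j , xⱼ , i⊏j@(i⊑j , _)) =
      let k , k-max , j⊑k = go (rec i⊏j) xⱼ in k , k-max , P.trans i⊑j j⊑k

  maximals-antichain : (x : 𝔹^ n) → IsAntichain P (_∈ maximals x)
  maximals-antichain x i j i∈ j∈ = maximal-unique x
    (to (S-maximals x i) ([]=⇒lookup i∈)) (proj₁ (to (S-maximals x j) ([]=⇒lookup j∈)))

  -- Passing to the down-closure adds only elements strictly below some member of `x`, and none of
  -- these is maximal. The antichain condition keeps every member of `x` maximal.
  maximals-⊙ : (x : 𝔹^ n) → IsAntichain P (_∈ x) → maximals (x ⊙ M) ≡ x
  maximals-⊙ x antichain = S-injective (maximals (x ⊙ M)) x λ i → mk⇔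
    (λ s → let i-max         = to (S-maximals (x ⊙ M) i) s
               j , xⱼ , i⊑j = to (S-⊙ x M i) (proj₁ i-max)
           -- The member `j` of `x` above `i` is itself in the down-closure, so maximality of `i`
           -- forces `i ≡ j`.
           in subst (S x) (sym (maximal-unique (x ⊙ M) i-max (S-extensive xⱼ) i⊑j)) xⱼ)
    (λ xᵢ → from (S-maximals (x ⊙ M) i) (S-extensive xᵢ ,
      λ (j , s , i⊑j , i≢j) →
        let k , xₖ , j⊑k = to (S-⊙ x M j) s
            i≡k           = antichain i k (lookup⇒[]= i x xᵢ) (lookup⇒[]= k x xₖ)
                              (P.trans i⊑j j⊑k)
        -- Here `j` is squeezed between `i` and `k`, which coincide.
        in i≢j (P.antisym i⊑j (subst (j ⊑_) (sym i≡k) j⊑k))))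
    where
    S-extensive : ∀ {i} → S x i → S (x ⊙ M) i
    S-extensive {i} xᵢ = from (S-⊙ x M i) (i , xᵢ , P.refl)

  -- The ideal property gives one inclusion; `below-maximal`, hence finiteness, gives the other.
  ⊙-maximals : (x : 𝔹^ n) → IsOrderIdeal P (S x) → maximals x ⊙ M ≡ x
  ⊙-maximals x ideal = S-injective (maximals x ⊙ M) x λ i → mk⇔
    (λ s → let j , j∈ , i⊑j = to (S-⊙ (maximals x) M i) s in
      ideal j i (proj₁ (to (S-maximals x j) j∈)) i⊑j)
    (λ xᵢ → let j , j-max , i⊑j = below-maximal x i xᵢ in
      from (S-⊙ (maximals x) M i) (j , from (S-maximals x j) j-max , i⊑j))

-- Duplicate-free lists with the same members are permutations of each other, so they have equal
-- length. The maps are inverse only where `P` and `Q` hold, since taking down-closures is not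
-- injective on all vectors.
card-bijection : {P : Pred (𝔹^ n) p} {Q : Pred (𝔹^ n) q} (P? : Decidable P) (Q? : Decidable Q)
  (f g : 𝔹^ n → 𝔹^ n) → (∀ x → P x → Q (f x)) → (∀ y → Q y → P (g y)) →
  (∀ x → P x → g (f x) ≡ x) → (∀ y → Q y → f (g y) ≡ y) → card P P? ≡ card Q Q?
card-bijection {n = n} {P = P} {Q = Q} P? Q? f g P⇒Q Q⇒P g∘f f∘g = begin
  length Ps          ≡⟨ length-map f Ps ⟨
  length (map f Ps)  ≡⟨ ↭-length (∼bag⇒↭ (unique∧set⇒bag
                          fPs-unique (Unique.filter⁺ Q? (vectors-unique n)) (mk⇔ fPs⊆Qs Qs⊆fPs))) ⟩
  length Qs          ∎
  where
  open ≡-Reasoning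

  Ps Qs : List (𝔹^ n)
  Ps = filter P? (vectors n)
  Qs = filter Q? (vectors n)

  gfPs≡Ps : map g (map f Ps) ≡ Ps
  gfPs≡Ps = trans (sym (map-∘ Ps))
    (map-id-local (All.map (g∘f _) (All.all-filter P? (vectors n))))

  -- f is injective only on P, so uniqueness is pulled back along g instead.
  fPs-unique : Unique (map f Ps)
  fPs-unique = Unique.map⁻ (subst Unique (sym gfPs≡Ps) (Unique.filter⁺ P? (vectors-unique n)))

  fPs⊆Qs : ∀ {y} → y ∈ₗ map f Ps → y ∈ₗ Qs
  fPs⊆Qs y∈ with x , x∈ , refl ← ∈-map⁻ f y∈ =
    ∈-filter⁺ Q? (vectors-complete (f x)) (P⇒Q x (proj₂ (∈-filter⁻ P? {xs = vectors n} x∈)))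

  Qs⊆fPs : ∀ {y} → y ∈ₗ Qs → y ∈ₗ map f Ps
  Qs⊆fPs {y} y∈ = let qy = proj₂ (∈-filter⁻ Q? {xs = vectors n} y∈) in
    subst (_∈ₗ map f Ps) (f∘g y qy)
      (∈-map⁺ f (∈-filter⁺ P? (vectors-complete (g y)) (Q⇒P y qy)))

theorem6p4 : ∀ (n : ℕ) →
    (∀ (x : 𝔹^ n) → (x ⊙ 𝐏 n ≡ x) ⇔ IsOrderIdeal (ℙ n) (S x))
    × D-P n ≡ card (λ (x : 𝔹^ n) → x ⊙ 𝐏 n ≡ x) (λ x → (x ⊙ 𝐏 n) ≟ x)
theorem6p4 n = fixed⇔ideal , card-bijection antichain? (λ x → (x ⊙ 𝐏 n) ≟ x)
  (_⊙ 𝐏 n) (maximals (𝐏 n) ≼-isPartialOrder)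
  -- A down-closure is an order ideal, hence a fixed vector.
  (λ A _ → from (fixed⇔ideal (A ⊙ 𝐏 n)) (⊙-orderIdeal (𝐏 n) ≼-isPartialOrder A))
  (λ x _ → maximals-antichain (𝐏 n) ≼-isPartialOrder x)
  (maximals-⊙ (𝐏 n) ≼-isPartialOrder)
  (λ x fixed → ⊙-maximals (𝐏 n) ≼-isPartialOrder x (to (fixed⇔ideal x) fixed))
  where
  fixed⇔ideal : ∀ x → (x ⊙ 𝐏 n ≡ x) ⇔ IsOrderIdeal (ℙ n) (S x)
  fixed⇔ideal = fixed⇔orderIdeal (𝐏 n) ≼-isPartialOrder
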